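{- Let $b\ge 2$ and $n\ge 0$ be integers. Then $T_b(n)=\langle\{s_0,s_1,\dots,s_{n+1}\}\rangle$, and $\{s_0,s_1,\dots,s_{n+1}\}$ is the minimal system of generators of $T_b(n)$. In particular the embedding dimension is $e(T_b(n))=n+2$.
   Context: For integers $b\ge 2$, $n\ge 0$, $i\ge0$ put $s_i=(b+1)b^{n+i}-1$ and $T_b(n)=\langle\{s_i:i\in\mathbb{N}\}\rangle$, the submonoid of $(\mathbb{N},+)$ generated by the $s_i$. A set $A$ is a system of generators of a numerical semigroup $S$ if $S=\langle A\rangle$; it is minimal if no proper subset of $A$ generates $S$ (every numerical semigroup has a unique minimal system of generators, which is finite). The embedding dimension $e(S)$ is the cardinality of the minimal system of generators. -}

module Defs where

open import Data.Fin using (Fin)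
open import Data.List using (List; upTo)
open import Data.List.Membership.Propositional.Properties using (∈-upTo⁺)
import Data.List.Membership.Propositional as List
open import Data.Nat using (ℕ; zero; suc; _+_; _*_; _∸_; _^_; _≤_)
open import Data.Nat.DivMod using (_/_; _%_; m≡m%n+[m/n]*n; m%n<n; /-monoˡ-≤; m*n/n≡m)
open import Data.Nat.Properties using (≮⇒≥; _<?_; *-comm; *-identityˡ; ≤-trans; <⇒≤; ≤-reflexive; m∸n+n≡m)
open import Data.Nat.Tactic.RingSolver using (solve-∀)
open import Data.Product using (Σ-syntax; ∃-syntax; _×_; _,_)
open import Function.Definitions using (Injective)
open import Level using (0ℓ)
open import Relation.Binary.PropositionalEquality using (_≡_; refl; sym; trans; cong; subst)
open import Relation.Nullary using (¬_; yes; no; contradiction)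
open import Relation.Unary using (Pred; _∈_; _∉_; _⊂_; _≐_)

Subsetℕ : Set₁
Subsetℕ = Pred ℕ 0ℓ

data ⟨_⟩ (A : Subsetℕ) : Subsetℕ where
  gen  : ∀ {x} → x ∈ A → x ∈ ⟨ A ⟩
  zero : 0 ∈ ⟨ A ⟩
  add  : ∀ {x y} → x ∈ ⟨ A ⟩ → y ∈ ⟨ A ⟩ → x + y ∈ ⟨ A ⟩

record NumericalSemigroup : Set₁ where
  field
    Elements         : Subsetℕ
    0-closed         : 0 ∈ Elements
    +-closed         : ∀ {x y} → x ∈ Elements → y ∈ Elements → x + y ∈ Elements
    finiteComplement : Σ[ gaps ∈ List ℕ ] (∀ m → m ∉ Elements → m List.∈ gaps)

open NumericalSemigroup public using (Elements)

IsSystemOfGenerators : Subsetℕ → NumericalSemigroup → Set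
IsSystemOfGenerators A S = Elements S ≐ ⟨ A ⟩

IsMinimalSystem : Subsetℕ → NumericalSemigroup → Set₁
IsMinimalSystem A S =
  IsSystemOfGenerators A S ×
  (∀ (B : Subsetℕ) → B ⊂ A → ¬ IsSystemOfGenerators B S)

-- Uniqueness is part of the definition: that every numerical semigroup has
-- a unique minimal system is a classical fact, not available constructively
-- for an undecidable S.
IsTheMinimalSystem : Subsetℕ → NumericalSemigroup → Set₁
IsTheMinimalSystem A S =
  IsMinimalSystem A S ×
  (∀ (B : Subsetℕ) → IsMinimalSystem B S → B ≐ A)

HasCardinality : Subsetℕ → ℕ → Set
HasCardinality A k =
  Σ[ f ∈ (Fin k → ℕ) ] Injective _≡_ _≡_ f × A ≐ (λ x → ∃[ j ] x ≡ f j)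

-- e(S) = k, as a relation; it is functional because the minimal system is
-- required to be unique.
HasEmbeddingDimension : NumericalSemigroup → ℕ → Set₁
HasEmbeddingDimension S k =
  Σ[ A ∈ Subsetℕ ] IsTheMinimalSystem A S × HasCardinality A k

-- For b ≥ 1 the product is positive, so the subtraction is not truncated.
s : ℕ → ℕ → ℕ → ℕ
s b n i = (b + 1) * b ^ (n + i) ∸ 1

allGenerators : ℕ → ℕ → Subsetℕ
allGenerators b n x = ∃[ i ] x ≡ s b n i

generatorsUpTo : ℕ → ℕ → ℕ → Subsetℕ
generatorsUpTo b n k x = ∃[ i ] i ≤ k × x ≡ s b n i

private
  multiple : ∀ {A x} k → x ∈ ⟨ A ⟩ → k * x ∈ ⟨ A ⟩
  multiple zero    p = zero
  multiple (suc k) p = add p (multiple k p)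

  -- If x and x + 1 lie in a submonoid, so does m = (q - r) x + r (x + 1),
  -- where m = r + q x is division with remainder and r ≤ q.
  consecutive⇒cofinite : ∀ {A} x → x ∈ ⟨ A ⟩ → suc x ∈ ⟨ A ⟩ →
                         ∀ m → x * x ≤ m → m ∈ ⟨ A ⟩
  consecutive⇒cofinite {A} zero p p′ m _ =
    subst (_∈ ⟨ A ⟩) (trans (*-comm m 1) (*-identityˡ m)) (multiple m p′)
  consecutive⇒cofinite {A} x@(suc _) p p′ m x²≤m =
    subst (_∈ ⟨ A ⟩) eq (add (multiple (q ∸ r) p) (multiple r p′))
    where
    q r : ℕ
    q = m / x
    r = m % x

    x≤q : x ≤ q
    x≤q = ≤-trans (≤-reflexive (sym (m*n/n≡m x x))) (/-monoˡ-≤ x x²≤m)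

    rearrange : ∀ d r x → d * x + r * suc x ≡ r + (d + r) * x
    rearrange = solve-∀

    eq : (q ∸ r) * x + r * suc x ≡ m
    eq = trans (rearrange (q ∸ r) r x)
        (trans (cong (λ t → r + t * x) (m∸n+n≡m (≤-trans (<⇒≤ (m%n<n m x)) x≤q)))
               (sym (m≡m%n+[m/n]*n m x)))

  quotient : ∀ c k → ∃[ q ] (suc c + 1) * suc c ^ k ≡ 2 + c * q
  quotient c zero = 1 , base c
    where
    base : ∀ c → (suc c + 1) * 1 ≡ 2 + c * 1
    base = solve-∀
  quotient c (suc k) with quotient c k
  ... | q , eq = 2 + q + c * q ,
        trans (assoc c (suc c ^ k)) (trans (cong (suc c *_) eq) (step c q))
    where
    assoc : ∀ c p → (suc c + 1) * (suc c * p) ≡ suc c * ((suc c + 1) * p)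
    assoc = solve-∀
    step : ∀ c q → suc c * (2 + c * q) ≡ 2 + c * (2 + q + c * q)
    step = solve-∀

  -- With b = c + 1 and s₀ = 1 + c q one has s₁ = b s₀ + c, hence
  -- q s₁ + 1 = (q b + 1) s₀.
  T-consecutive : ∀ b n → 2 ≤ b →
    ∃[ x ] x ∈ ⟨ allGenerators b n ⟩ × suc x ∈ ⟨ allGenerators b n ⟩
  T-consecutive (suc c) n _ with quotient c (n + 0)
  ... | q , eq =
    q * s b n 1 , multiple q (gen (1 , refl)) ,
    subst (_∈ ⟨ allGenerators b n ⟩) (sym bezout) (multiple (q * b + 1) (gen (0 , refl)))
    where
    b : ℕ
    b = suc c

    s₀≡ : s b n 0 ≡ 1 + c * q
    s₀≡ = cong (_∸ 1) eq

    shift : ∀ c p → (suc c + 1) * (suc c * p) ≡ suc c * ((suc c + 1) * p)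
    shift = solve-∀

    expand : ∀ c q → suc c * (2 + c * q) ≡ suc (suc c * (1 + c * q) + c)
    expand = solve-∀

    s₁≡ : s b n 1 ≡ b * (1 + c * q) + c
    s₁≡ = cong (_∸ 1) (trans (cong (λ e → (b + 1) * b ^ e) (n+1≡ n))
            (trans (shift c (b ^ (n + 0))) (trans (cong (b *_) eq) (expand c q))))
      where
      n+1≡ : ∀ n → n + 1 ≡ suc (n + 0)
      n+1≡ = solve-∀

    identity : ∀ c q → suc (q * (suc c * (1 + c * q) + c)) ≡ (q * suc c + 1) * (1 + c * q)
    identity = solve-∀

    bezout : suc (q * s b n 1) ≡ (q * b + 1) * s b n 0
    bezout = trans (cong (λ t → suc (q * t)) s₁≡)
            (trans (identity c q) (cong ((q * b + 1) *_) (sym s₀≡)))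

  T-finiteComplement : ∀ b n → 2 ≤ b →
    Σ[ gaps ∈ List ℕ ] (∀ m → m ∉ ⟨ allGenerators b n ⟩ → m List.∈ gaps)
  T-finiteComplement b n 2≤b with T-consecutive b n 2≤b
  ... | x , p , p′ = upTo (x * x) , λ m m∉ → small m m∉
    where
    small : ∀ m → m ∉ ⟨ allGenerators b n ⟩ → m List.∈ upTo (x * x)
    small m m∉ with m <? x * x
    ... | yes m<x² = ∈-upTo⁺ m<x²
    ... | no  m≮x² = contradiction (consecutive⇒cofinite x p p′ m (≮⇒≥ m≮x²)) m∉

T : (b n : ℕ) → 2 ≤ b → NumericalSemigroup
T b n 2≤b = record
  { Elements         = ⟨ allGenerators b n ⟩
  ; 0-closed         = zero
  ; +-closed         = add
  ; finiteComplement = T-finiteComplement b n 2≤b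
  }

{-# OPTIONS --safe #-}
-- Write D = (b + 1) bⁿ, so that sᵢ + 1 = D bⁱ.  Every sᵢ with i ≥ n + 2 is redundant because
--   s_{n+2+i} = s_{1+i} + bⁱ (s_n + (b^{n+2} − bⁿ − 1) s_0).
-- For i ≤ n + 1, sᵢ is an atom of T_b(n): a sum of k generators equals D M − k, where M ≥ k
-- is a sum of k powers of b.  If it equals sᵢ = D bⁱ − 1, then k = 1 + D t and M = bⁱ + t
-- for some t, and M ≥ k together with bⁱ ≤ b^{n+1} < D forces t = 0, hence k = 1.
-- Atoms belong to every system of generators, which gives minimality and uniqueness.
module Submission where

open import Defs
open import Data.Fin using (toℕ; fromℕ<)
open import Data.Fin.Properties using (toℕ-injective; toℕ-fromℕ<; toℕ<n)
open import Data.Nat using (ℕ; zero; suc; _+_; _*_; _∸_; _^_; _≤_; _<_; z≤n; s≤s; s≤s⁻¹; NonZero; >-nonZero)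
open import Data.Nat.Induction using (<-rec)
open import Data.Nat.Properties
open import Data.Nat.Tactic.RingSolver using (solve-∀)
open import Data.Product using (∃-syntax; _×_; _,_; proj₂)
open import Data.Sum using (_⊎_; inj₁; inj₂)
open import Function.Definitions using (Injective)
open import Relation.Binary.Definitions using (tri<; tri≈; tri>)
open import Relation.Binary.PropositionalEquality using (_≡_; _≢_; refl; sym; trans; cong; cong₂; subst)
open import Relation.Nullary using (¬_; yes; no; contradiction)
open import Relation.Nullary.Decidable using (map′)
open import Relation.Unary using (_∈_; _⊆_; _⊂_; _≐_; Decidable)

-- Generated submonoids, atoms and minimal systems

⟨⟩-multiple : ∀ {A x} k → x ∈ ⟨ A ⟩ → k * x ∈ ⟨ A ⟩
⟨⟩-multiple zero    _ = zero
⟨⟩-multiple (suc k) p = add p (⟨⟩-multiple k p)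

⟨⟩-least : ∀ {A B} → A ⊆ ⟨ B ⟩ → ⟨ A ⟩ ⊆ ⟨ B ⟩
⟨⟩-least A⊆ (gen p)   = A⊆ p
⟨⟩-least A⊆ zero      = zero
⟨⟩-least A⊆ (add p q) = add (⟨⟩-least A⊆ p) (⟨⟩-least A⊆ q)

IsAtom : Subsetℕ → ℕ → Set
IsAtom S a = a ≢ 0 × (∀ {x y} → x ∈ S → y ∈ S → x + y ≡ a → x ≡ 0 ⊎ y ≡ 0)

-- Induction on the derivation: if the atom arises as a sum, one summand vanishes, so the other is
-- the same atom with a shorter derivation, ending in `gen`.
atom-generator : ∀ {B S a} → ⟨ B ⟩ ⊆ S → IsAtom S a → a ∈ ⟨ B ⟩ → a ∈ B
atom-generator ⊆S atom (gen a∈B) = a∈B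
atom-generator ⊆S (0≢0 , _) zero = contradiction refl 0≢0
atom-generator {B} {S} ⊆S atom (add {x} {y} p q) with proj₂ atom (⊆S p) (⊆S q) refl
... | inj₁ refl = atom-generator ⊆S atom q
... | inj₂ refl = subst (_∈ B) (sym (+-identityʳ x))
                    (atom-generator ⊆S (subst (IsAtom S) (+-identityʳ x) atom) p)

-- Decidability of A is what makes uniqueness constructive.
atoms⇒theMinimalSystem : ∀ {A} S → Decidable A → IsSystemOfGenerators A S →
                         (∀ {a} → a ∈ A → IsAtom (Elements S) a) → IsTheMinimalSystem A S
atoms⇒theMinimalSystem {A} S A? A-gens atoms = (A-gens , minimal) , unique
  where
  contained : ∀ B → IsSystemOfGenerators B S → A ⊆ B
  contained B (S⊆ , ⊆S) a∈A = atom-generator ⊆S (atoms a∈A) (S⊆ (proj₂ A-gens (gen a∈A)))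

  minimal : ∀ B → B ⊂ A → ¬ IsSystemOfGenerators B S
  minimal B (_ , A⊈B) B-gens = A⊈B (contained B B-gens)

  unique : ∀ B → IsMinimalSystem B S → B ≐ A
  unique B (B-gens , B-min) = B⊆A , contained B B-gens
    where
    B⊆A : B ⊆ A
    B⊆A {x} x∈B with A? x
    ... | yes x∈A = x∈A
    -- Since `A` lies in `B`, such an `x` makes `A` a proper subset of `B` that still generates `S`,
    -- against the minimality of `B`.
    ... | no  x∉A = contradiction A-gens
                      (B-min A (contained B B-gens , λ B⊆A → x∉A (B⊆A x∈B)))

-- Arithmetic of the generators and redundancy of the large ones

suc-s : ∀ b n i → 2 ≤ b → suc (s b n i) ≡ (b + 1) * b ^ n * b ^ i
suc-s b@(suc _) n i 2≤b =
  trans (m+[n∸m]≡n (*-mono-≤ (m≤n+m 1 b) (m^n>0 b (n + i))))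
  (trans (cong ((b + 1) *_) (^-distribˡ-+-* b n i)) (sym (*-assoc (b + 1) (b ^ n) (b ^ i))))

^-injectiveʳ : ∀ {b} → 1 < b → Injective _≡_ _≡_ (b ^_)
^-injectiveʳ {b} 1<b {i} {j} eq with <-cmp i j
... | tri< i<j _ _ = contradiction eq (<⇒≢ (^-monoʳ-< b 1<b i<j))
... | tri≈ _ i≡j _ = i≡j
... | tri> _ _ j<i = contradiction (sym eq) (<⇒≢ (^-monoʳ-< b 1<b j<i))

s-injective : ∀ b n → 2 ≤ b → Injective _≡_ _≡_ (s b n)
s-injective b@(suc _) n 2≤b {i} {j} eq =
  ^-injectiveʳ 2≤b (*-cancelˡ-≡ (b ^ i) (b ^ j) ((b + 1) * b ^ n) {{D≢0}}
    (trans (sym (suc-s b n i 2≤b)) (trans (cong suc eq) (suc-s b n j 2≤b))))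
  where
  D≢0 : NonZero ((b + 1) * b ^ n)
  D≢0 = >-nonZero (*-mono-≤ (m≤n+m 1 b) (m^n>0 b n))

-- Take i = 0; the general case is this one scaled by b^i. In s_n + c s_0 the subtracted ones add up
-- to 1 + c = b^n (b^2 - 1) = (b - 1) D, a multiple of D, so the sum is D (b^n + c - b + 1) = D
-- b^{n+2} - D b.
s-recurrence : ∀ b n → 2 ≤ b → ∃[ c ] ∀ i →
  s b n (n + 2 + i) ≡ s b n (1 + i) + b ^ i * (s b n n + c * s b n 0)
s-recurrence b@(suc (suc a)) n 2≤b@(s≤s (s≤s _)) = c , λ i → suc-injective (step i)
  where
  -- With b = 2 + a and bⁿ = 1 + m, the numbers c = b^{n+2} − bⁿ − 1, s_0 and s_n are
  -- subtraction-free polynomials in a and m.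
  m c s₀ sₙ : ℕ
  m = b ^ n ∸ 1
  c = 2 + 4 * a + a * a + m * (3 + 4 * a + a * a)
  s₀ = 2 + a + 3 * m + a * m
  sₙ = m + suc m * s₀

  bⁿ≡ : b ^ n ≡ suc m
  bⁿ≡ = sym (m+[n∸m]≡n (m^n>0 b n))

  s₀≡ : s b n 0 ≡ s₀
  s₀≡ = suc-injective (trans (suc-s b n 0 2≤b)
          (trans (cong (λ N → (b + 1) * N * 1) bⁿ≡) (expand a m)))
    where
    expand : ∀ a m → (2 + a + 1) * suc m * 1 ≡ suc (2 + a + 3 * m + a * m)
    expand = solve-∀

  sₙ≡ : s b n n ≡ sₙ
  sₙ≡ = suc-injective (trans (suc-s b n n 2≤b)
          (trans (cong (λ N → (b + 1) * N * N) bⁿ≡) (expand a m)))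
    where
    expand : ∀ a m → (2 + a + 1) * suc m * suc m ≡ suc (m + suc m * (2 + a + 3 * m + a * m))
    expand = solve-∀

  identity : ∀ a m p → (2 + a + 1) * suc m * (suc m * ((2 + a) * ((2 + a) * 1)) * p) ≡
    (2 + a + 1) * suc m * ((2 + a) * p) +
    p * (m + suc m * (2 + a + 3 * m + a * m) +
         (2 + 4 * a + a * a + m * (3 + 4 * a + a * a)) * (2 + a + 3 * m + a * m))
  identity = solve-∀

  step : ∀ i → suc (s b n (n + 2 + i)) ≡
               suc (s b n (1 + i)) + b ^ i * (s b n n + c * s b n 0)
  step i = trans (suc-s b n (n + 2 + i) 2≤b)
    (trans (cong ((b + 1) * b ^ n *_)
             (trans (^-distribˡ-+-* b (n + 2) i) (cong (_* b ^ i) (^-distribˡ-+-* b n 2))))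
    (trans (cong (λ N → (b + 1) * N * (N * b ^ 2 * b ^ i)) bⁿ≡)
    (trans (identity a m (b ^ i))
    (cong₂ (λ u v → u + b ^ i * v)
      (trans (cong (λ N → (b + 1) * N * (b * b ^ i)) (sym bⁿ≡)) (sym (suc-s b n (1 + i) 2≤b)))
      (cong₂ (λ u v → u + c * v) (sym sₙ≡) (sym s₀≡))))))

s∈⟨generatorsUpTo⟩ : ∀ b n → 2 ≤ b → ∀ i → s b n i ∈ ⟨ generatorsUpTo b n (n + 1) ⟩
s∈⟨generatorsUpTo⟩ b n 2≤b with s-recurrence b n 2≤b
... | c , recurrence = <-rec _ go
  where
  G = ⟨ generatorsUpTo b n (n + 1) ⟩

  go : ∀ i → (∀ {j} → j < i → s b n j ∈ G) → s b n i ∈ G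
  go i rec with i ≤? n + 1
  ... | yes i≤n+1 = gen (i , i≤n+1 , refl)
  -- Here i = n + 2 + j. The terms s_n and s_0 are among the first generators, so only s_{1+j} needs
  -- the induction hypothesis.
  ... | no  i≰n+1 = subst (λ k → s b n k ∈ G) i≡ (subst (_∈ G) (sym (recurrence j))
          (add (rec 1+j<i)
               (⟨⟩-multiple (b ^ j) (add (gen (n , m≤m+n n 1 , refl))
                                         (⟨⟩-multiple c (gen (0 , z≤n , refl)))))))
    where
    j = i ∸ (n + 2)
    i≡ : n + 2 + j ≡ i
    i≡ = m+[n∸m]≡n (subst (_≤ i) (sym (+-suc n 1)) (≰⇒> i≰n+1))
    1+j<i : 1 + j < i
    1+j<i = subst (2 + j ≤_) i≡ (+-monoˡ-≤ j (m≤n+m 2 n))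

-- The first n + 2 generators are atoms

-- x is a sum of k generators, and M is the corresponding sum of k powers of b.
element-shape : ∀ b n → 2 ≤ b → ∀ {x} → x ∈ ⟨ allGenerators b n ⟩ →
  ∃[ k ] ∃[ M ] x + k ≡ (b + 1) * b ^ n * M × k ≤ M × (x ≢ 0 → 1 ≤ k)
element-shape b@(suc _) n 2≤b (gen (i , refl)) =
  1 , b ^ i , trans (+-comm (s b n i) 1) (suc-s b n i 2≤b) , m^n>0 b i , λ _ → ≤-refl
element-shape b n 2≤b zero =
  0 , 0 , sym (*-zeroʳ ((b + 1) * b ^ n)) , z≤n , λ 0≢0 → contradiction refl 0≢0
element-shape b n 2≤b (add {x} {y} p q)
  with element-shape b n 2≤b p | element-shape b n 2≤b q
... | k , M , eq , k≤M , pos | l , L , eq′ , l≤L , pos′ =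
  k + l , M + L ,
  trans (interchange x y k l) (trans (cong₂ _+_ eq eq′) (sym (*-distribˡ-+ ((b + 1) * b ^ n) M L))) ,
  +-mono-≤ k≤M l≤L , positive
  where
  interchange : ∀ x y k l → x + y + (k + l) ≡ x + k + (y + l)
  interchange = solve-∀
  positive : x + y ≢ 0 → 1 ≤ k + l
  positive x+y≢0 with x ≟ 0
  ... | no  x≢0 = ≤-trans (pos x≢0) (m≤m+n k l)
  ... | yes refl = ≤-trans (pos′ x+y≢0) (m≤n+m l k)

-- Writing M = P + t and cancelling gives k = D t. If t ≥ 1, then M = P + t ≤ (P + 1) t ≤ D t = k,
-- contradicting k < M.
one-summand : ∀ D P k M → P < D → D * P + k ≡ D * M → suc k ≤ M → k ≡ 0
one-summand D P k M P<D eq k<M with m≤n⇒∃[o]m+o≡n P≤M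
  where
  P≤M : P ≤ M
  P≤M = *-cancelˡ-≤ D {{>-nonZero (≤-trans (s≤s z≤n) P<D)}} (subst (D * P ≤_) eq (m≤m+n (D * P) k))
... | t , refl with +-cancelˡ-≡ (D * P) k (D * t) (trans eq (*-distribˡ-+ D P t))
... | refl with t
... | zero  = *-zeroʳ D
... | suc u = contradiction k<M (<⇒≱ (s≤s bound))
  where
  expand : ∀ P u → suc P * suc u ≡ P + suc u + P * u
  expand = solve-∀
  bound : P + suc u ≤ D * suc u
  bound = ≤-trans (subst (P + suc u ≤_) (sym (expand P u)) (m≤m+n _ _)) (*-monoˡ-≤ (suc u) P<D)

s-atom : ∀ b n → 2 ≤ b → ∀ i → i ≤ n + 1 → IsAtom ⟨ allGenerators b n ⟩ (s b n i)
s-atom b@(suc _) n 2≤b i i≤n+1 = nonzero , atom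
  where
  D : ℕ
  D = (b + 1) * b ^ n

  -- As D = b^{n+1} + b^n, the bound i ≤ n + 1 is sharp here: b^{n+2} already exceeds D.
  bⁱ<D : b ^ i < D
  bⁱ<D = begin-strict
    b ^ i             ≤⟨ ^-monoʳ-≤ b i≤n+1 ⟩
    b ^ (n + 1)       ≡⟨ cong (b ^_) (+-comm n 1) ⟩
    b * b ^ n         <⟨ *-monoˡ-< (b ^ n) {{m^n≢0 b n}} (m<m+n b (s≤s z≤n)) ⟩
    (b + 1) * b ^ n   ∎
    where open ≤-Reasoning

  nonzero : s b n i ≢ 0
  nonzero s≡0 = <⇒≢ 1<Dbⁱ (trans (cong suc (sym s≡0)) (suc-s b n i 2≤b))
    where
    1<Dbⁱ : 1 < D * b ^ i
    1<Dbⁱ = *-mono-≤ (≤-trans (s≤s (m^n>0 b i)) bⁱ<D) (m^n>0 b i)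

  atom : ∀ {x y} → x ∈ ⟨ allGenerators b n ⟩ → y ∈ ⟨ allGenerators b n ⟩ →
         x + y ≡ s b n i → x ≡ 0 ⊎ y ≡ 0
  atom {x} {y} p q x+y≡s with x ≟ 0 | y ≟ 0
  ... | yes x≡0 | _       = inj₁ x≡0
  ... | no _    | yes y≡0 = inj₂ y≡0
  ... | no x≢0  | no y≢0  with element-shape b n 2≤b p | element-shape b n 2≤b q
  ... | suc k , M , eq , k<M , _ | suc l , L , eq′ , l<L , _ =
    -- There are k + l + 2 summands in all; one of them is absorbed by the 1 in D b^i = s_i + 1.
    contradiction (one-summand D (b ^ i) (k + suc l) (M + L) bⁱ<D total (+-mono-≤ k<M l<L))
                  (λ k+1+l≡0 → 1+n≢0 (trans (sym (+-suc k l)) k+1+l≡0))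
    where
    interchange : ∀ x y k l → suc (x + y) + (k + suc l) ≡ x + suc k + (y + suc l)
    interchange = solve-∀
    total : D * b ^ i + (k + suc l) ≡ D * (M + L)
    total = trans (cong (_+ (k + suc l)) (sym (trans (cong suc x+y≡s) (suc-s b n i 2≤b))))
      (trans (interchange x y k l) (trans (cong₂ _+_ eq eq′) (sym (*-distribˡ-+ D M L))))
  -- A nonzero element cannot be an empty sum.
  ... | zero  , _ , _ , _ , pos | _ = contradiction (pos x≢0) λ ()
  ... | suc _ , _ | zero , _ , _ , _ , pos = contradiction (pos y≢0) λ ()

-- Decidability, cardinality and conclusion

generatorsUpTo? : ∀ b n k → Decidable (generatorsUpTo b n k)
generatorsUpTo? b n k x = map′ (λ (i , i<1+k , eq) → i , s≤s⁻¹ i<1+k , eq)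
                               (λ (i , i≤k , eq) → i , s≤s i≤k , eq)
                               (anyUpTo? (λ i → x ≟ s b n i) (suc k))

generatorsUpTo-cardinality : ∀ b n k → 2 ≤ b → HasCardinality (generatorsUpTo b n k) (suc k)
generatorsUpTo-cardinality b n k 2≤b =
  (λ j → s b n (toℕ j)) ,
  (λ eq → toℕ-injective (s-injective b n 2≤b eq)) ,
  (λ (i , i≤k , eq) → fromℕ< (s≤s i≤k) , trans eq (cong (s b n) (sym (toℕ-fromℕ< (s≤s i≤k))))) ,
  (λ (j , eq) → toℕ j , s≤s⁻¹ (toℕ<n j) , eq)

mainTheorem4 : (b n : ℕ) (2≤b : 2 ≤ b) →
    (Elements (T b n 2≤b) ≐ ⟨ generatorsUpTo b n (n + 1) ⟩) ×
    IsTheMinimalSystem (generatorsUpTo b n (n + 1)) (T b n 2≤b) ×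
    HasEmbeddingDimension (T b n 2≤b) (n + 2)
mainTheorem4 b n 2≤b = generates , theMinimal ,
  (generatorsUpTo b n (n + 1) , theMinimal ,
   subst (HasCardinality (generatorsUpTo b n (n + 1))) (sym (+-suc n 1))
         (generatorsUpTo-cardinality b n (n + 1) 2≤b))
  where
  generates : Elements (T b n 2≤b) ≐ ⟨ generatorsUpTo b n (n + 1) ⟩
  generates = ⟨⟩-least (λ { (i , refl) → s∈⟨generatorsUpTo⟩ b n 2≤b i }) ,
              ⟨⟩-least (λ (i , _ , eq) → gen (i , eq))

  theMinimal : IsTheMinimalSystem (generatorsUpTo b n (n + 1)) (T b n 2≤b)
  theMinimal = atoms⇒theMinimalSystem (T b n 2≤b) (generatorsUpTo? b n (n + 1)) generates
                 (λ { (i , i≤n+1 , refl) → s-atom b n 2≤b i i≤n+1 })
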